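{- Let $\Gamma$ be a metrized graph with vertex set $V(\Gamma)$ and edge set $E(\Gamma)$, and let $r$ be its resistance function. Let $e_i \in E(\Gamma)$ be an edge of length $L_i$ with end points $p_i$ and $q_i$. If both $x$ and $y$ belong to the same edge $e_i$, then $$r(x,y)= |x-y|-(x-y)^2\, \frac{L_i - r(p_i,q_i)}{L_i^2},$$ where on the right-hand side $x,y\in[0,L_i]$ denote the parameters of the points $x,y\in e_i$.
   Context: A metrized graph $\Gamma$ is a finite connected graph whose edges are equipped with a distinguished parametrization by line segments (multiple edges and self-loops are allowed). The valence of $p\in\Gamma$ is the number of directions emanating from $p$. A vertex set $V(\Gamma)$ is a finite non-empty subset of $\Gamma$ containing every point of valence $\neq 2$ (additional points of valence 2 may be included). The set $E(\Gamma)$ of edges is the set of closed line segments with end points in $V(\Gamma)$ into which $V(\Gamma)$ divides $\Gamma$; the length of $e_i$ is a positive real number $L_i$. Parametrization convention: an edge $e_i$ of length $L_i$ with end points $p_i,q_i$ is identified with $[0,L_i]$ so that $p_i$ corresponds to $0$ and $q_i$ to $L_i$. A point of $e_i$ and the corresponding real number in $[0,L_i]$ are denoted by the same letter: in the arguments of $r$ the letters denote points of $\Gamma$, elsewhere in formulas they denote the real parameters. Voltage and resistance functions: view $\Gamma$ as a resistive electric circuit in which each edge has resistance equal to its length. For $x,y,z\in\Gamma$, $j_z(x,y)$ is the voltage difference between $x$ and $z$ when unit current enters at $y$ and exits at $z$ (with reference voltage $0$ at $z$). Equivalently, for fixed $y,z$, $x\mapsto j_z(x,y)$ is the unique continuous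 piecewise affine function $f$ on $\Gamma$ with $f(z)=0$ and $\Delta f=\delta_y-\delta_z$, where $\Delta f=-\sum_{p}\sigma_p(f)\,\delta_p$ and $\sigma_p(f)$ is the sum of the slopes of $f$ in all directions emanating from $p$. The resistance function is $r(x,y)=j_y(x,x)$, the effective resistance between $x$ and $y$. -}

module Defs where

open import Algebra.Bundles using (CommutativeRing)
open import Data.Bool.Base using (if_then_else_)
open import Data.Fin.Base using (Fin)
open import Data.Fin.Properties using () renaming (_≟_ to _≟ᶠ_)
open import Data.List.Base using (List; []; _∷_; _++_; map; filter; foldr; allFin)
open import Data.List.Relation.Binary.Pointwise using (Pointwise)
open import Data.Nat.Base using (ℕ; NonZero)
open import Data.Product.Base using (∃; _×_; _,_; proj₁)
open import Level using (Level; _⊔_; suc)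
open import Relation.Binary.Construct.Closure.Equivalence using (EqClosure)
open import Relation.Binary.Core using (Rel)
open import Relation.Binary.Definitions using (Decidable)
open import Relation.Binary.PropositionalEquality.Core using (_≡_; refl)
open import Relation.Binary.Structures using (IsDecTotalOrder)
import Relation.Binary.Construct.NonStrictToStrict as ToStrict
open import Relation.Nullary.Decidable.Core using (yes; no; does)
open import Relation.Nullary.Negation.Core using (¬_)
open import Relation.Unary using (Pred)

-- The real numbers, given by their (classical) axioms as a Dedekind-complete
-- ordered field.  `_⁻¹` is total, but nothing is assumed about `0# ⁻¹`.
record RealNumbers (c ℓ₁ ℓ₂ : Level) : Set (suc (c ⊔ ℓ₁ ⊔ ℓ₂)) where
  field
    commutativeRing : CommutativeRing c ℓ₁

  open CommutativeRing commutativeRing public renaming (refl to ≈-refl)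

  infix  4 _≤_
  infix  8 _⁻¹
  field
    1≉0             : ¬ (1# ≈ 0#)
    _⁻¹             : Carrier → Carrier
    *-inverseʳ      : ∀ x → ¬ (x ≈ 0#) → x * x ⁻¹ ≈ 1#

    _≤_             : Rel Carrier ℓ₂
    isDecTotalOrder : IsDecTotalOrder _≈_ _≤_
    +-monoʳ-≤       : ∀ x {y z} → y ≤ z → x + y ≤ x + z
    *-nonNeg        : ∀ {x y} → 0# ≤ x → 0# ≤ y → 0# ≤ x * y

  IsUpperBound : ∀ {ℓ} → Pred Carrier ℓ → Pred Carrier (c ⊔ ℓ₂ ⊔ ℓ)
  IsUpperBound P b = ∀ {x} → P x → x ≤ b

  field
    supremum : (P : Pred Carrier (c ⊔ ℓ₁ ⊔ ℓ₂)) → ∃ P → ∃ (IsUpperBound P) →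
               ∃ λ s → IsUpperBound P s × (∀ {b} → IsUpperBound P b → s ≤ b)

  open IsDecTotalOrder isDecTotalOrder public using (_≟_; _≤?_) renaming (reflexive to ≤-reflexive)
  open ToStrict _≈_ _≤_ public using (_<_)

  infixl 7 _/_
  _/_ : Carrier → Carrier → Carrier
  x / y = x * y ⁻¹

  infix 8 _²
  _² : Carrier → Carrier
  x ² = x * x

  ∣_∣ : Carrier → Carrier
  ∣ x ∣ = if does (0# ≤? x) then x else - x

module _ {c ℓ₁ ℓ₂} (ℝ : RealNumbers c ℓ₁ ℓ₂) where
  open RealNumbers ℝ

  -- A metrized graph together with a vertex set.  A vertex set cuts Γ into
  -- finitely many closed segments, so the pair (Γ , V(Γ)) is the geometric
  -- realization of a finite connected weighted multigraph (loops and multiple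
  -- edges allowed).  `source e` is the end point p_e at parameter 0 and
  -- `target e` the end point q_e at parameter `len e`.
  record MetrizedGraph : Set (c ⊔ ℓ₁ ⊔ ℓ₂) where
    field
      #V #E    : ℕ
      nonEmpty : NonZero #V

    Vertex : Set
    Vertex = Fin #V

    Edge : Set
    Edge = Fin #E

    field
      source target : Edge → Vertex
      len           : Edge → Carrier
      len-positive  : ∀ e → 0# < len e

    Joined : Rel Vertex _
    Joined u v = ∃ λ e → source e ≡ u × target e ≡ v

    field
      connected : ∀ u v → EqClosure Joined u v

module _ {c ℓ₁ ℓ₂} {ℝ : RealNumbers c ℓ₁ ℓ₂} (Γ : MetrizedGraph ℝ) where
  open RealNumbers ℝ
  open MetrizedGraph Γ

  -- The points of Γ, each represented once up to `_≈ᴾ_`: either a vertex, or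
  -- a point with parameter 0 < t < len e in the interior of an edge e.
  data Point : Set (c ⊔ ℓ₁ ⊔ ℓ₂) where
    vertex   : Vertex → Point
    interior : (e : Edge) (t : Carrier) → 0# < t → t < len e → Point

  infix 4 _≈ᴾ_
  data _≈ᴾ_ : Rel Point (c ⊔ ℓ₁ ⊔ ℓ₂) where
    vertex   : ∀ {v} → vertex v ≈ᴾ vertex v
    interior : ∀ {e s t 0<s s<L 0<t t<L} → s ≈ t →
               interior e s 0<s s<L ≈ᴾ interior e t 0<t t<L

  _≟ᴾ_ : Decidable _≈ᴾ_
  vertex u ≟ᴾ vertex v with u ≟ᶠ v
  ... | yes refl = yes vertex
  ... | no  u≢v  = no λ { vertex → u≢v refl }
  vertex _ ≟ᴾ interior _ _ _ _ = no λ ()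
  interior _ _ _ _ ≟ᴾ vertex _ = no λ ()
  interior e s _ _ ≟ᴾ interior e′ t _ _ with e ≟ᶠ e′ | s ≟ t
  ... | yes refl | yes s≈t = yes (interior s≈t)
  ... | yes refl | no  s≉t = no λ { (interior s≈t) → s≉t s≈t }
  ... | no  e≢e′ | _       = no λ { (interior _) → e≢e′ refl }

  -- The parameter interval [0 , len e] of an edge.
  record Parameter (e : Edge) : Set (c ⊔ ℓ₂) where
    constructor [_,_,_]
    field
      value   : Carrier
      0≤value : 0# ≤ value
      value≤L : value ≤ len e
  open Parameter public

  -- The point of Γ with a given parameter.  For a loop, the parameters 0 and
  -- len e give the same point.
  pointAt : (e : Edge) → Parameter e → Point
  pointAt e [ t , 0≤t , t≤L ] with t ≟ 0# | t ≟ len e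
  ... | yes _   | _       = vertex (source e)
  ... | no  _   | yes _   = vertex (target e)
  ... | no  t≉0 | no  t≉L = interior e t (0≤t , λ 0≈t → t≉0 (sym 0≈t)) (t≤L , t≉L)

  -- A direction emanating from a point of Γ: a base parameter on an edge
  -- together with a sense of travel along that edge.
  data Sense : Set where
    forward backward : Sense

  record Direction : Set (c ⊔ ℓ₂) where
    constructor direction
    field
      edge  : Edge
      base  : Parameter edge
      sense : Sense

  atSource atTarget : (e : Edge) → Parameter e
  atSource e = [ 0# , ≤-reflexive ≈-refl , proj₁ (len-positive e) ]
  atTarget e = [ len e , proj₁ (len-positive e) , ≤-reflexive ≈-refl ]

  -- All directions emanating from a point; its length is the valence.  A loop
  -- contributes two directions at its vertex.
  directions : Point → List Direction
  directions (vertex v) =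
    map (λ e → direction e (atSource e) forward)
        (filter (λ e → source e ≟ᶠ v) (allFin #E))
    ++
    map (λ e → direction e (atTarget e) backward)
        (filter (λ e → target e ≟ᶠ v) (allFin #E))
  directions (interior e t (0≤t , _) (t≤L , _)) =
    direction e [ t , 0≤t , t≤L ] forward ∷
    direction e [ t , 0≤t , t≤L ] backward ∷ []

  AffineOn : (Point → Carrier) → (e : Edge) → Rel Carrier (c ⊔ ℓ₁ ⊔ ℓ₂)
  AffineOn f e a b =
    ∃ λ m → ∃ λ k → (u : Parameter e) → a ≤ value u → value u ≤ b →
    f (pointAt e u) ≈ m * value u + k

  -- Continuous and piecewise affine on the part a ≤ t ≤ b of the edge e.  The
  -- finitely many pieces are closed intervals, so adjacent pieces agree at
  -- their common break point; this is where continuity is built in.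
  data PiecewiseAffineOn (f : Point → Carrier) (e : Edge) :
                         Rel Carrier (c ⊔ ℓ₁ ⊔ ℓ₂) where
    piece : ∀ {a b} → a < b → AffineOn f e a b → PiecewiseAffineOn f e a b
    join  : ∀ {a b d} → PiecewiseAffineOn f e a b → PiecewiseAffineOn f e b d →
            PiecewiseAffineOn f e a d

  -- A function on Γ is continuous iff it is continuous on every closed edge.
  record ContinuousPiecewiseAffine (f : Point → Carrier) :
                                   Set (c ⊔ ℓ₁ ⊔ ℓ₂) where
    field
      cong            : ∀ {p q} → p ≈ᴾ q → f p ≈ f q
      piecewiseAffine : ∀ e → PiecewiseAffineOn f e 0# (len e)

  -- `HasSlope f d m`: sufficiently close to its base point, f is affine with
  -- slope m in the direction d, with respect to the distance travelled.
  HasSlope : (Point → Carrier) → Direction → Carrier → Set (c ⊔ ℓ₁ ⊔ ℓ₂)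
  HasSlope f (direction e s forward) m =
    ∃ λ ε → 0# < ε × ((u : Parameter e) → value s ≤ value u → value u ≤ value s + ε →
    f (pointAt e u) - f (pointAt e s) ≈ m * (value u - value s))
  HasSlope f (direction e s backward) m =
    ∃ λ ε → 0# < ε × ((u : Parameter e) → value s - ε ≤ value u → value u ≤ value s →
    f (pointAt e u) - f (pointAt e s) ≈ m * (value s - value u))

  -- σ_p(f) = σ
  IsSlopeSum : (Point → Carrier) → Point → Carrier → Set (c ⊔ ℓ₁ ⊔ ℓ₂)
  IsSlopeSum f p σ =
    ∃ λ ms → Pointwise (HasSlope f) (directions p) ms × σ ≈ foldr _+_ 0# ms

  -- Δ f = μ, where a discrete measure is represented by its point masses.
  IsLaplacian : (f μ : Point → Carrier) → Set (c ⊔ ℓ₁ ⊔ ℓ₂)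
  IsLaplacian f μ = ∀ p → ∃ λ σ → IsSlopeSum f p σ × μ p ≈ - σ

  δ : Point → Point → Carrier
  δ q p = if does (q ≟ᴾ p) then 1# else 0#

  -- f = j_z(· , y)
  record IsVoltage (y z : Point) (f : Point → Carrier) :
                   Set (c ⊔ ℓ₁ ⊔ ℓ₂) where
    field
      continuousPiecewiseAffine : ContinuousPiecewiseAffine f
      grounded                  : f z ≈ 0#
      laplacian                 : IsLaplacian f (λ p → δ y p - δ z p)

  -- The voltage function j_z(x , y), written `j z x y`; it is determined
  -- uniquely by this property.
  IsVoltageFunction : (j : Point → Point → Point → Carrier) → Set (c ⊔ ℓ₁ ⊔ ℓ₂)
  IsVoltageFunction j = ∀ y z → IsVoltage y z (λ x → j z x y)

  -- r is the resistance function of Γ: r(x , y) = j_y(x , x).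
  IsResistanceFunction : (r : Point → Point → Carrier) → Set (c ⊔ ℓ₁ ⊔ ℓ₂)
  IsResistanceFunction r =
    ∃ λ j → IsVoltageFunction j × (∀ x y → r x y ≈ j y x x)

{-# OPTIONS --safe #-}

-- Let p and q be the end points of e, f = j_q(· , p) and h = j_y(· , x) with
-- x < y on e, d = y - x.  The function f is affine on e with slope
-- k = - r(p , q) / L, and h has slopes m + 1, m, m + 1 on the three parts of e
-- cut off by x and y.  Pairing each function with the Laplacian of the other,
-- all edges other than e contribute symmetrically (Green's identity), so that
-- h(p) - h(q) = - k d.  Since also h(q) - h(p) = (m + 1) L - d, this determines
-- m, and r(x , y) = h(x) - h(y) = - m d.  No uniqueness of voltages is needed.
-- Carrying a charge ρ = ± 1 covers the case y < x as well, by regarding h as a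
-- dipole of charge - 1 from y to x.
module Submission where

open import Defs

open import Algebra.Bundles using (CommutativeRing)
open import Algebra.Solver.Ring.AlmostCommutativeRing
  using (fromCommutativeRing; _-Raw-AlmostCommutative⟶_)
open import Data.Bool.Base using (Bool; true; false; if_then_else_)
open import Data.Fin.Base using (Fin; zero; suc)
import Data.Fin.Properties as Fin
open import Data.Integer.Base as ℤ using (ℤ; -[1+_]; _⊖_) renaming (+_ to pos)
import Data.Integer.Properties as ℤ
open import Data.List.Base using ([]; _∷_; _++_; map; filter; foldr; tabulate; allFin)
open import Data.List.Relation.Binary.Pointwise using (Pointwise; []; _∷_)
open import Data.Maybe.Base as Maybe using (Maybe)
open import Data.Nat.Base as ℕ using (zero; suc)
open import Data.Product.Base using (∃; _×_; _,_; proj₁; proj₂)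
open import Level using (_⊔_)
open import Relation.Binary.Bundles using (DecTotalOrder)
import Relation.Binary.Construct.NonStrictToStrict as ToStrict
open import Relation.Binary.PropositionalEquality.Core as ≡ using (_≡_; _≢_)
open import Relation.Binary.Structures using (IsDecTotalOrder)
open import Relation.Nullary.Decidable.Core using (Dec; yes; no; does; dec⇒maybe)
open import Relation.Nullary.Negation.Core using (¬_; contradiction)
open import Relation.Unary using (Pred; Decidable)

-- Integer coefficients for ring identities.

-- The ring solver over an abstract ring cancels terms only if its coefficients
-- have a computing equality test, hence the coefficients in ℤ.
module IntegerCoefficients {c ℓ} (R : CommutativeRing c ℓ) where
  open CommutativeRing R
  open import Algebra.Properties.Ring ring
  open import Algebra.Properties.Semiring.Mult semiring using (×-homo-+; ×1-homo-*) renaming (_×_ to _·_)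
  open import Algebra.Properties.CommutativeSemigroup +-commutativeSemigroup using (interchange)
  open import Relation.Binary.Reasoning.Setoid setoid

  ⟦_⟧ : ℤ → Carrier
  ⟦ pos n ⟧    = n · 1#
  ⟦ -[1+ n ] ⟧ = - (suc n · 1#)

  ⟦⟧-homo-⊖ : ∀ m n → ⟦ m ⊖ n ⟧ ≈ m · 1# - n · 1#
  ⟦⟧-homo-⊖ m zero = begin
    m · 1#       ≈⟨ +-identityʳ _ ⟨
    m · 1# + 0#  ≈⟨ +-congˡ -0#≈0# ⟨
    m · 1# - 0#  ∎
  ⟦⟧-homo-⊖ zero    (suc n) = sym (+-identityˡ _)
  ⟦⟧-homo-⊖ (suc m) (suc n) = begin
    ⟦ suc m ⊖ suc n ⟧                    ≡⟨ ≡.cong ⟦_⟧ (ℤ.[1+m]⊖[1+n]≡m⊖n m n) ⟩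
    ⟦ m ⊖ n ⟧                            ≈⟨ ⟦⟧-homo-⊖ m n ⟩
    m · 1# - n · 1#                      ≈⟨ +-identityˡ _ ⟨
    0# + (m · 1# - n · 1#)               ≈⟨ +-congʳ (-‿inverseʳ 1#) ⟨
    (1# - 1#) + (m · 1# - n · 1#)        ≈⟨ interchange _ _ _ _ ⟩
    (1# + m · 1#) + (- 1# + - (n · 1#))  ≈⟨ +-congˡ (-‿+-comm _ _) ⟩
    suc m · 1# - suc n · 1#              ∎

  ⟦⟧-homo-+ : ∀ i j → ⟦ i ℤ.+ j ⟧ ≈ ⟦ i ⟧ + ⟦ j ⟧
  ⟦⟧-homo-+ (pos m)  (pos n)  = ×-homo-+ 1# m n
  ⟦⟧-homo-+ (pos m)  -[1+ n ] = ⟦⟧-homo-⊖ m (suc n)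
  ⟦⟧-homo-+ -[1+ m ] (pos n)  = trans (⟦⟧-homo-⊖ n (suc m)) (+-comm _ _)
  ⟦⟧-homo-+ -[1+ m ] -[1+ n ] = begin
    - ((2 ℕ.+ (m ℕ.+ n)) · 1#)        ≡⟨ ≡.cong (λ k → - (suc k · 1#)) (ℕ.+-suc m n) ⟨
    - ((suc m ℕ.+ suc n) · 1#)        ≈⟨ -‿cong (×-homo-+ 1# (suc m) (suc n)) ⟩
    - (suc m · 1# + suc n · 1#)       ≈⟨ -‿+-comm _ _ ⟨
    - (suc m · 1#) - suc n · 1#       ∎
    where import Data.Nat.Properties as ℕ

  ⟦⟧-homo-neg : ∀ i → ⟦ ℤ.- i ⟧ ≈ - ⟦ i ⟧
  ⟦⟧-homo-neg (pos zero)    = sym -0#≈0#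
  ⟦⟧-homo-neg (pos (suc n)) = refl
  ⟦⟧-homo-neg -[1+ n ]      = sym (-‿involutive _)

  ⟦⟧-homo-pos-* : ∀ m j → ⟦ pos m ℤ.* j ⟧ ≈ ⟦ pos m ⟧ * ⟦ j ⟧
  ⟦⟧-homo-pos-* m j = signed j
    where
    unsigned : ∀ n → ⟦ pos m ℤ.* pos n ⟧ ≈ ⟦ pos m ⟧ * ⟦ pos n ⟧
    unsigned n = begin
      ⟦ pos m ℤ.* pos n ⟧  ≡⟨ ≡.cong ⟦_⟧ (ℤ.pos-* m n) ⟨
      (m ℕ.* n) · 1#       ≈⟨ ×1-homo-* m n ⟩
      (m · 1#) * (n · 1#)  ∎

    signed : ∀ j → ⟦ pos m ℤ.* j ⟧ ≈ ⟦ pos m ⟧ * ⟦ j ⟧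
    signed (pos n)  = unsigned n
    signed -[1+ n ] = begin
      ⟦ pos m ℤ.* -[1+ n ] ⟧           ≡⟨ ≡.cong ⟦_⟧ (ℤ.neg-distribʳ-* (pos m) (pos (suc n))) ⟨
      ⟦ ℤ.- (pos m ℤ.* pos (suc n)) ⟧  ≈⟨ ⟦⟧-homo-neg (pos m ℤ.* pos (suc n)) ⟩
      - ⟦ pos m ℤ.* pos (suc n) ⟧      ≈⟨ -‿cong (unsigned (suc n)) ⟩
      - (⟦ pos m ⟧ * (suc n · 1#))     ≈⟨ -‿distribʳ-* _ _ ⟩
      ⟦ pos m ⟧ * ⟦ -[1+ n ] ⟧         ∎

  ⟦⟧-homo-* : ∀ i j → ⟦ i ℤ.* j ⟧ ≈ ⟦ i ⟧ * ⟦ j ⟧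
  ⟦⟧-homo-* (pos m)  j = ⟦⟧-homo-pos-* m j
  ⟦⟧-homo-* -[1+ m ] j = begin
    ⟦ -[1+ m ] ℤ.* j ⟧           ≡⟨ ≡.cong ⟦_⟧ (ℤ.neg-distribˡ-* (pos (suc m)) j) ⟨
    ⟦ ℤ.- (pos (suc m) ℤ.* j) ⟧  ≈⟨ ⟦⟧-homo-neg (pos (suc m) ℤ.* j) ⟩
    - ⟦ pos (suc m) ℤ.* j ⟧      ≈⟨ -‿cong (⟦⟧-homo-pos-* (suc m) j) ⟩
    - ((suc m · 1#) * ⟦ j ⟧)     ≈⟨ -‿distribˡ-* _ _ ⟩
    ⟦ -[1+ m ] ⟧ * ⟦ j ⟧         ∎

  morphism : ℤ.+-*-rawRing -Raw-AlmostCommutative⟶ fromCommutativeRing R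
  morphism = record
    { ⟦_⟧    = ⟦_⟧
    ; +-homo = ⟦⟧-homo-+
    ; *-homo = ⟦⟧-homo-*
    ; -‿homo = ⟦⟧-homo-neg
    ; 0-homo = refl
    ; 1-homo = +-identityʳ 1#
    }

  -- Only equality is ever certified: distinct integers can have equal images in a ring of positive
  -- characteristic, so a failed test proves nothing.
  _≟-image_ : ∀ i j → Maybe (⟦ i ⟧ ≈ ⟦ j ⟧)
  i ≟-image j = Maybe.map (λ i≡j → reflexive (≡.cong ⟦_⟧ i≡j)) (dec⇒maybe (i ℤ.≟ j))

  open import Algebra.Solver.Ring ℤ.+-*-rawRing (fromCommutativeRing R) morphism _≟-image_ public
    using (solve; _:=_; _:+_; _:*_; _:-_; :-_; con)

-- Order and field arithmetic of the real numbers.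

module RealProperties {c ℓ₁ ℓ₂} (ℝ : RealNumbers c ℓ₁ ℓ₂) where
  open RealNumbers ℝ hiding (zero)
  open IsDecTotalOrder isDecTotalOrder public
    using (≤-respˡ-≈; ≤-respʳ-≈) renaming (refl to ≤-refl; trans to ≤-trans; antisym to ≤-antisym)

  decTotalOrder : DecTotalOrder c ℓ₁ ℓ₂
  decTotalOrder = record { isDecTotalOrder = isDecTotalOrder }

  open import Relation.Binary.Properties.DecTotalOrder decTotalOrder public
    using (<-trans; <⇒≉; <⇒≱; ≰⇒>; <-respʳ-≈)
  open import Algebra.Properties.Ring ring using (+-cancelˡ; x∙y⁻¹≈ε⇒x≈y)
  open IntegerCoefficients commutativeRing
  open import Relation.Binary.Reasoning.Setoid setoid

  <-≤-trans : ∀ {x y z} → x < y → y ≤ z → x < z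
  <-≤-trans = ToStrict.<-≤-trans _≈_ _≤_ sym ≤-trans ≤-antisym ≤-respʳ-≈

  ≤-<-trans : ∀ {x y z} → x ≤ y → y < z → x < z
  ≤-<-trans = ToStrict.≤-<-trans _≈_ _≤_ ≤-trans ≤-antisym ≤-respˡ-≈

  x<x+ε : ∀ x {ε} → 0# < ε → x < x + ε
  x<x+ε x (0≤ε , 0≉ε) =
    ≤-respˡ-≈ (+-identityʳ x) (+-monoʳ-≤ x 0≤ε) ,
    λ x≈x+ε → 0≉ε (+-cancelˡ x _ _ (trans (+-identityʳ x) x≈x+ε))

  x-ε<x : ∀ x {ε} → 0# < ε → x - ε < x
  x-ε<x x {ε} 0<ε =
    <-respʳ-≈ (solve 2 (λ x ε → x :- ε :+ ε := x) ≈-refl x ε) (x<x+ε (x - ε) 0<ε)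

  -- The witness is the smaller of `s + ε` and `b`: a point different from `s` that lies both in a
  -- given affine piece and in the range where a slope at `s` is valid.
  near-right : ∀ {s b ε} → s < b → 0# < ε → ∃ λ u → s < u × u ≤ b × u ≤ s + ε
  near-right {s} {b} {ε} s<b 0<ε with s + ε ≤? b
  ... | yes s+ε≤b = s + ε , x<x+ε s 0<ε , s+ε≤b , ≤-refl
  ... | no  s+ε≰b = b , s<b , ≤-refl , proj₁ (≰⇒> s+ε≰b)

  near-left : ∀ {a s ε} → a < s → 0# < ε → ∃ λ u → u < s × a ≤ u × s - ε ≤ u
  near-left {a} {s} {ε} a<s 0<ε with a ≤? s - ε
  ... | yes a≤s-ε = s - ε , x-ε<x s 0<ε , a≤s-ε , ≤-refl
  ... | no  a≰s-ε = a , a<s , ≤-refl , proj₁ (≰⇒> a≰s-ε)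

  x≤y⇒0≤y-x : ∀ {x y} → x ≤ y → 0# ≤ y - x
  x≤y⇒0≤y-x {x} {y} x≤y =
    ≤-respʳ-≈ (+-comm _ _) (≤-respˡ-≈ (-‿inverseˡ x) (+-monoʳ-≤ (- x) x≤y))

  0≤y-x⇒x≤y : ∀ {x y} → 0# ≤ y - x → x ≤ y
  0≤y-x⇒x≤y {x} {y} 0≤y-x =
    ≤-respʳ-≈ (solve 2 (λ x y → x :+ (y :- x) := y) ≈-refl x y)
      (≤-respˡ-≈ (+-identityʳ x) (+-monoʳ-≤ x 0≤y-x))

  nonNeg⇒∣x∣≈x : ∀ {x} → 0# ≤ x → ∣ x ∣ ≈ x
  nonNeg⇒∣x∣≈x {x} 0≤x with 0# ≤? x
  ... | yes _   = ≈-refl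
  ... | no  0≰x = contradiction 0≤x 0≰x

  neg⇒∣x∣≈-x : ∀ {x} → ¬ (0# ≤ x) → ∣ x ∣ ≈ - x
  neg⇒∣x∣≈-x {x} 0≰x with 0# ≤? x
  ... | yes 0≤x = contradiction 0≤x 0≰x
  ... | no  _   = ≈-refl

  *-cancelʳ : ∀ {x y z} → ¬ (z ≈ 0#) → x * z ≈ y * z → x ≈ y
  *-cancelʳ {x} {y} {z} z≉0 xz≈yz = begin
    x               ≈⟨ cancel x ⟨
    x * z * z ⁻¹    ≈⟨ *-congʳ xz≈yz ⟩
    y * z * z ⁻¹    ≈⟨ cancel y ⟩
    y               ∎
    where
    cancel : ∀ w → w * z * z ⁻¹ ≈ w
    cancel w = trans (*-assoc w z (z ⁻¹)) (trans (*-congˡ (*-inverseʳ z z≉0)) (*-identityʳ w))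

  *-nonZero : ∀ {x y} → ¬ (x ≈ 0#) → ¬ (y ≈ 0#) → ¬ (x * y ≈ 0#)
  *-nonZero x≉0 y≉0 xy≈0 = x≉0 (*-cancelʳ y≉0 (trans xy≈0 (sym (zeroˡ _))))

  x-y≉0 : ∀ {x y} → ¬ (x ≈ y) → ¬ (x - y ≈ 0#)
  x-y≉0 x≉y x-y≈0 = x≉y (x∙y⁻¹≈ε⇒x≈y _ _ x-y≈0)

  -- An equation x ≈ y follows from equations xᵢ ≈ yᵢ once the solver exhibits
  -- x - y as a combination of the differences xᵢ - yᵢ.
  infixl 6 _⊞_
  infixl 7 _⊡_

  difference : ∀ {x y} → x ≈ y → x - y ≈ 0#
  difference x≈y = trans (+-congʳ x≈y) (-‿inverseʳ _)

  _⊡_ : ∀ c {x y} → x ≈ y → c * (x - y) ≈ 0#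
  c ⊡ x≈y = trans (*-congˡ (difference x≈y)) (zeroʳ c)

  _⊞_ : ∀ {x y} → x ≈ 0# → y ≈ 0# → x + y ≈ 0#
  x≈0 ⊞ y≈0 = trans (+-cong x≈0 y≈0) (+-identityˡ 0#)

  combine : ∀ {x y z} → x - y ≈ z → z ≈ 0# → x ≈ y
  combine {x} {y} x-y≈z z≈0 = x∙y⁻¹≈ε⇒x≈y x y (trans x-y≈z z≈0)

-- Algebraic identities for increments, edge balances and resistance.

module CircuitAlgebra {c ℓ₁ ℓ₂} (ℝ : RealNumbers c ℓ₁ ℓ₂) where
  open RealNumbers ℝ hiding (zero)
  open RealProperties ℝ
  open IntegerCoefficients commutativeRing
  open import Relation.Binary.Reasoning.Setoid setoid

  -- The three increments telescope. Slope `m + ρ` along all of the edge would give `(m + ρ) * L`;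
  -- the middle part of length `y - x` falls short of that by `ρ` per unit length.
  increments : ∀ {m ρ x y L H₀ H₁ a b} →
    a - H₀ ≈ (m + ρ) * x → b - a ≈ m * (y - x) → H₁ - b ≈ (m + ρ) * (L - y) →
    H₁ - H₀ ≈ (m + ρ) * L - ρ * (y - x)
  increments {m} {ρ} {x} {y} {L} {H₀} {H₁} {a} {b} before between after = combine
    (solve 9 (λ m ρ x y L H₀ H₁ a b →
         H₁ :- H₀ :- ((m :+ ρ) :* L :- ρ :* (y :- x))
         := (a :- H₀ :- (m :+ ρ) :* x) :+ (b :- a :- m :* (y :- x))
            :+ (H₁ :- b :- (m :+ ρ) :* (L :- y)))
       ≈-refl m ρ x y L H₀ H₁ a b)
    (difference before ⊞ difference between ⊞ difference after)

  -- Boundary terms of Green's identity on the edge carrying the dipole, with `M` the outer slope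
  -- `m + ρ` and `q` the shortfall `ρ * d`. Charges sitting at an end of the edge are recorded by
  -- `ιx` and `ιy`; apart from them, both sides equal `- (k * M * L)`.
  charged-edge-balance : ∀ {M ρ ιx ιy q L k F₀ F₁ H₀ H₁} →
    F₁ - F₀ ≈ k * L → H₁ - H₀ ≈ M * L - q →
    F₀ * (M - ρ * ιx) + F₁ * (- M + ρ * ιy) ≈
    - (ρ * (ιx * F₀ - ιy * F₁)) - k * q + (H₀ * k + H₁ * - k)
  charged-edge-balance {M} {ρ} {ιx} {ιy} {q} {L} {k} {F₀} {F₁} {H₀} {H₁} F-F≈ H-H≈ = combine
    (solve 11 (λ M ρ ιx ιy q L k F₀ F₁ H₀ H₁ →
         F₀ :* (M :- ρ :* ιx) :+ F₁ :* (:- M :+ ρ :* ιy)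
         :- (:- (ρ :* (ιx :* F₀ :- ιy :* F₁)) :- k :* q :+ (H₀ :* k :+ H₁ :* :- k))
         := :- M :* (F₁ :- F₀ :- k :* L) :+ k :* (H₁ :- H₀ :- (M :* L :- q)))
       ≈-refl M ρ ιx ιy q L k F₀ F₁ H₀ H₁)
    (- M ⊡ F-F≈ ⊞ k ⊡ H-H≈)

  -- Both sides equal `- (n * k * L)`, the product of slopes and length being symmetric in the two
  -- functions. The summand `0#` is the defect term, which vanishes on such an edge.
  harmonic-edge-balance : ∀ {n L k F₀ F₁ H₀ H₁} → F₁ - F₀ ≈ k * L → H₁ - H₀ ≈ n * L →
    F₀ * n + F₁ * - n ≈ 0# + (H₀ * k + H₁ * - k)
  harmonic-edge-balance {n} {L} {k} {F₀} {F₁} {H₀} {H₁} F-F≈ H-H≈ = combine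
    (solve 7 (λ n L k F₀ F₁ H₀ H₁ →
         F₀ :* n :+ F₁ :* :- n :- (con (pos 0) :+ (H₀ :* k :+ H₁ :* :- k))
         := :- n :* (F₁ :- F₀ :- k :* L) :+ k :* (H₁ :- H₀ :- n :* L))
       ≈-refl n L k F₀ F₁ H₀ H₁)
    (- n ⊡ F-F≈ ⊞ k ⊡ H-H≈)

  -- Here `z` is the contribution of charges located at vertices; it enters Green's identity on both
  -- sides and drops out.
  charge-balance : ∀ {z q w} → z ≈ z - q + - w → w ≈ - q
  charge-balance {z} {q} {w} eq = combine
    (solve 3 (λ z q w → w :- :- q := z :- (z :- q :+ :- w)) ≈-refl z q w)
    (difference eq)

  -- The drop is `- (m * d)`, that is `ρ * d - (m + ρ) * d`. Adding the two expressions for the end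
  -- point differences gives `(m + ρ) * L ≈ ρ * d + k * (ρ * d)`, and multiplying this by `d / L`
  -- turns `(m + ρ) * d` into the quadratic term.
  resistance-formula : ∀ {m ρ d L k R H₀ H₁ a b} → ¬ (L ≈ 0#) →
    b - a ≈ m * d → H₁ - H₀ ≈ (m + ρ) * L - ρ * d → H₀ - H₁ ≈ - (k * (ρ * d)) →
    k * L ≈ - R → a - b ≈ ρ * (d - d ² * ((L - R) / L ²))
  resistance-formula {m} {ρ} {d} {L} {k} {R} {H₀} {H₁} {a} {b} L≉0 b-a≈ H₁-H₀≈ H₀-H₁≈ kL≈ = combine
    (solve 6 (λ m ρ d z a b →
         a :- b :- ρ :* (d :- z) := m :* d :- (b :- a) :+ (ρ :* z :- (m :+ ρ) :* d))
       ≈-refl m ρ d (d ² * ((L - R) * J)) a b)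
    (difference (sym b-a≈) ⊞ difference (sym slope-d))
    where
    J : Carrier
    J = (L ²) ⁻¹

    slope-L : (m + ρ) * L ≈ ρ * d + k * (ρ * d)
    slope-L = combine
      (solve 5 (λ ML q kq H₀ H₁ → ML :- (q :+ kq) :=
           (ML :- q :- (H₁ :- H₀)) :+ (:- kq :- (H₀ :- H₁)))
         ≈-refl ((m + ρ) * L) (ρ * d) (k * (ρ * d)) H₀ H₁)
      (difference (sym H₁-H₀≈) ⊞ difference (sym H₀-H₁≈))

    J-inverse : ∀ z → z * (L * L * J) ≈ z
    J-inverse z = trans (*-congˡ (*-inverseʳ _ (*-nonZero L≉0 L≉0))) (*-identityʳ z)

    slope-d : (m + ρ) * d ≈ ρ * (d ² * ((L - R) * J))
    slope-d = begin
      (m + ρ) * d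
        ≈⟨ J-inverse _ ⟨
      -- One factor `L` makes `slope-L` applicable; the other turns `1 + k` into `L + k * L`, which
      -- is `L - R`.
      (m + ρ) * d * (L * L * J)
        ≈⟨ solve 4 (λ M d L J → M :* d :* (L :* L :* J) := M :* L :* (d :* L :* J)) ≈-refl (m + ρ) d L J ⟩
      (m + ρ) * L * (d * L * J)
        ≈⟨ *-congʳ slope-L ⟩
      (ρ * d + k * (ρ * d)) * (d * L * J)
        ≈⟨ solve 5 (λ ρ d k L J →
               (ρ :* d :+ k :* (ρ :* d)) :* (d :* L :* J) := ρ :* (d :* d :* ((L :+ k :* L) :* J)))
             ≈-refl ρ d k L J ⟩
      ρ * (d ² * ((L + k * L) * J))
        ≈⟨ *-congˡ (*-congˡ (*-congʳ (+-congˡ kL≈))) ⟩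
      ρ * (d ² * ((L - R) * J)) ∎

-- Finite sums: indicators, filters and fibres.

module Sums {c ℓ} (R : CommutativeRing c ℓ) where
  open CommutativeRing R hiding (zero)
  open import Algebra.Properties.Semiring.Sum semiring public
  open import Relation.Binary.Reasoning.Setoid setoid

  ∑-indicator : ∀ {n} (j : Fin n) (x : Fin n → Carrier) →
                ∑[ i < n ] (if does (j Fin.≟ i) then x i else 0#) ≈ x j
  ∑-indicator {suc n} zero    x = trans (+-congˡ (sum-replicate-zero n)) (+-identityʳ _)
  ∑-indicator {suc n} (suc j) x = trans (+-identityˡ _) (∑-indicator j (λ i → x (suc i)))

  -- Turns the filtered edge lists in `directions` into sums over all edges. A general `tabulate t`
  -- replaces `allFin` because the induction shifts the indexing function.
  ∑-filter : ∀ {a p} {A : Set a} {P : Pred A p} (P? : Decidable P) (x : A → Carrier)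
             {n} (t : Fin n → A) →
             foldr (λ a s → x a + s) 0# (filter P? (tabulate t)) ≈
             ∑[ i < n ] (if does (P? (t i)) then x (t i) else 0#)
  ∑-filter P? x {zero}  t = refl
  ∑-filter P? x {suc n} t with does (P? (t zero))
  ... | true  = +-congˡ (∑-filter P? x (λ i → t (suc i)))
  ... | false = trans (∑-filter P? x (λ i → t (suc i))) (sym (+-identityˡ _))

  *-if : ∀ b x y → x * (if b then y else 0#) ≈ (if b then x * y else 0#)
  *-if true  x y = refl
  *-if false x y = zeroʳ x

  -- After exchanging the sums, each `e` contributes only at the single vertex `s e`.
  ∑-fibres : ∀ {m n} (s : Fin m → Fin n) (w : Fin n → Carrier) (x : Fin m → Carrier) →
             ∑[ v < n ] (w v * ∑[ e < m ] (if does (s e Fin.≟ v) then x e else 0#)) ≈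
             ∑[ e < m ] (w (s e) * x e)
  ∑-fibres {m} {n} s w x = begin
    ∑[ v < n ] (w v * ∑[ e < m ] (if does (s e Fin.≟ v) then x e else 0#))
      ≈⟨ sum-cong-≋ (λ v → trans (*-distribˡ-sum (w v) (λ e → if does (s e Fin.≟ v) then x e else 0#))
                                 (sum-cong-≋ (λ e → *-if (does (s e Fin.≟ v)) (w v) (x e)))) ⟩
    ∑[ v < n ] ∑[ e < m ] (if does (s e Fin.≟ v) then w v * x e else 0#)
      ≈⟨ ∑-comm (λ v e → if does (s e Fin.≟ v) then w v * x e else 0#) ⟩
    ∑[ e < m ] ∑[ v < n ] (if does (s e Fin.≟ v) then w v * x e else 0#)
      ≈⟨ sum-cong-≋ (λ e → ∑-indicator (s e) (λ v → w v * x e)) ⟩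
    ∑[ e < m ] (w (s e) * x e) ∎

  ∑-pairing-difference : ∀ {n} ρ (w x y : Fin n → Carrier) →
    ∑[ v < n ] (w v * - (ρ * (x v - y v))) ≈
    - (ρ * (∑[ v < n ] (w v * x v) - ∑[ v < n ] (w v * y v)))
  ∑-pairing-difference {n} ρ w x y = begin
    ∑[ v < n ] (w v * - (ρ * (x v - y v)))
      ≈⟨ sum-cong-≋ (λ v → solve 4 (λ ρ w x y → w :* (:- (ρ :* (x :- y))) := :- ρ :* (w :* x) :+ ρ :* (w :* y))
                             refl ρ (w v) (x v) (y v)) ⟩
    ∑[ v < n ] (- ρ * (w v * x v) + ρ * (w v * y v))
      ≈⟨ ∑-distrib-+ (λ v → - ρ * (w v * x v)) (λ v → ρ * (w v * y v)) ⟩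
    ∑[ v < n ] (- ρ * (w v * x v)) + ∑[ v < n ] (ρ * (w v * y v))
      ≈⟨ +-cong (*-distribˡ-sum (- ρ) (λ v → w v * x v)) (*-distribˡ-sum ρ (λ v → w v * y v)) ⟨
    - ρ * ∑[ v < n ] (w v * x v) + ρ * ∑[ v < n ] (w v * y v)
      ≈⟨ solve 3 (λ ρ x y → :- ρ :* x :+ ρ :* y := :- (ρ :* (x :- y))) refl ρ _ _ ⟩
    - (ρ * (∑[ v < n ] (w v * x v) - ∑[ v < n ] (w v * y v))) ∎
    where open IntegerCoefficients R

-- Points of an edge in terms of their parameters.

module Potentials {c ℓ₁ ℓ₂} {ℝ : RealNumbers c ℓ₁ ℓ₂} (Γ : MetrizedGraph ℝ) where
  open RealNumbers ℝ hiding (zero)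
  open RealProperties ℝ
  open MetrizedGraph Γ
  open IntegerCoefficients commutativeRing
  open Sums commutativeRing
  open CircuitAlgebra ℝ
  open import Relation.Binary.Reasoning.Setoid setoid

  private variable
    h      : Point Γ → Carrier
    e e′   : Edge
    a b    : Carrier

  pointAt-source : (u : Parameter Γ e) → value u ≈ 0# → pointAt Γ e u ≡ vertex (source e)
  pointAt-source [ t , _ , _ ] t≈0 with t ≟ 0#
  ... | yes _   = ≡.refl
  ... | no  t≉0 = contradiction t≈0 t≉0

  pointAt-target : (u : Parameter Γ e) → value u ≈ len e → pointAt Γ e u ≡ vertex (target e)
  pointAt-target {e} [ t , _ , _ ] t≈L with t ≟ 0# | t ≟ len e
  -- `pointAt` tests for parameter 0 first; positive length keeps the target from being taken for
  -- the source.
  ... | yes t≈0 | _       = contradiction (trans (sym t≈0) t≈L) (<⇒≉ (len-positive e))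
  ... | no  _   | yes _   = ≡.refl
  ... | no  _   | no  t≉L = contradiction t≈L t≉L

  -- Stated with `_≈ᴾ_` and not `_≡_` because `interior` stores order proofs, which may differ.
  pointAt-interior : (u : Parameter Γ e) (0<t : 0# < value u) (t<L : value u < len e) →
                     _≈ᴾ_ Γ (pointAt Γ e u) (interior e (value u) 0<t t<L)
  pointAt-interior {e} [ t , _ , _ ] 0<t t<L with t ≟ 0# | t ≟ len e
  ... | yes t≈0 | _       = contradiction (sym t≈0) (<⇒≉ 0<t)
  ... | no  _   | yes t≈L = contradiction t≈L (<⇒≉ t<L)
  ... | no  _   | no  _   = interior ≈-refl

  pointAt-interior⁻¹ : (u : Parameter Γ e) → ∀ {t} {0<t : 0# < t} {t<L : t < len e′} →
                       _≈ᴾ_ Γ (pointAt Γ e u) (interior e′ t 0<t t<L) → e ≡ e′ × value u ≈ t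
  pointAt-interior⁻¹ {e} [ s , _ , _ ] p with s ≟ 0# | s ≟ len e
  pointAt-interior⁻¹ [ s , _ , _ ] () | yes _ | _
  pointAt-interior⁻¹ [ s , _ , _ ] () | no _ | yes _
  pointAt-interior⁻¹ [ s , _ , _ ] (interior s≈t) | no _ | no _ = ≡.refl , s≈t

  pointAt-vertex⁻¹ : (u : Parameter Γ e) → 0# < value u → value u < len e → ∀ {v} →
                     ¬ (_≈ᴾ_ Γ (pointAt Γ e u) (vertex v))
  pointAt-vertex⁻¹ {e} [ t , _ , _ ] 0<t t<L p with t ≟ 0# | t ≟ len e
  ... | yes t≈0 | _       = contradiction (sym t≈0) (<⇒≉ 0<t)
  ... | no  _   | yes t≈L = contradiction t≈L (<⇒≉ t<L)
  pointAt-vertex⁻¹ [ t , _ , _ ] 0<t t<L () | no _ | no _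

  pointAt-cong : (u w : Parameter Γ e) → value u ≈ value w →
                 _≈ᴾ_ Γ (pointAt Γ e u) (pointAt Γ e w)
  pointAt-cong {e} [ s , _ , _ ] [ t , _ , _ ] s≈t with s ≟ 0# | t ≟ 0# | s ≟ len e | t ≟ len e
  ... | yes _   | yes _   | _       | _       = vertex
  ... | yes s≈0 | no  t≉0 | _       | _       = contradiction (trans (sym s≈t) s≈0) t≉0
  ... | no  s≉0 | yes t≈0 | _       | _       = contradiction (trans s≈t t≈0) s≉0
  ... | no  _   | no  _   | yes _   | yes _   = vertex
  ... | no  _   | no  _   | yes s≈L | no  t≉L = contradiction (trans (sym s≈t) s≈L) t≉L
  ... | no  _   | no  _   | no  s≉L | yes t≈L = contradiction (trans s≈t t≈L) s≉L
  ... | no  _   | no  _   | no  _   | no  _   = interior s≈t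

  δ-≈ : ∀ {p q} → _≈ᴾ_ Γ q p → δ Γ q p ≈ 1#
  δ-≈ {p} {q} q≈p with _≟ᴾ_ Γ q p
  ... | yes _   = ≈-refl
  ... | no  q≉p = contradiction q≈p q≉p

  δ-≉ : ∀ {p q} → ¬ (_≈ᴾ_ Γ q p) → δ Γ q p ≈ 0#
  δ-≉ {p} {q} q≉p with _≟ᴾ_ Γ q p
  ... | yes q≈p = contradiction q≈p q≉p
  ... | no  _   = ≈-refl

  -- Affine pieces and their slopes.

  Line : (Point Γ → Carrier) → Edge → (a b m k : Carrier) → Set _
  Line h e a b m k = (u : Parameter Γ e) → a ≤ value u → value u ≤ b →
                     h (pointAt Γ e u) ≈ m * value u + k

  Line-increment : ∀ h {m k} → Line h e a b m k → (u w : Parameter Γ e) →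
                   a ≤ value u → value u ≤ b → a ≤ value w → value w ≤ b →
                   h (pointAt Γ e w) - h (pointAt Γ e u) ≈ m * (value w - value u)
  Line-increment h {m} {k} line u w a≤u u≤b a≤w w≤b =
    trans (+-cong (line w a≤w w≤b) (-‿cong (line u a≤u u≤b)))
          (solve 4 (λ m k s t → m :* t :+ k :- (m :* s :+ k) := m :* (t :- s))
             ≈-refl m k (value u) (value w))

  -- The germ at `s` and the affine piece overlap in some point `t` beyond `s`; comparing the two
  -- increments there and cancelling `t - s` identifies the slopes.
  Line-slope-right : ∀ h {m k m′} (s : Parameter Γ e) → value s < b → b ≤ len e →
                     Line h e (value s) b m k → HasSlope Γ h (direction e s forward) m′ → m′ ≈ m
  Line-slope-right h {m} {m′ = m′} s s<b b≤L line (ε , 0<ε , affine)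
    with near-right s<b 0<ε
  ... | t , s<t , t≤b , t≤s+ε = *-cancelʳ (x-y≉0 λ t≈s → <⇒≉ s<t (sym t≈s)) (begin
    m′ * (t - value s)                            ≈⟨ affine u (proj₁ s<t) t≤s+ε ⟨
    h (pointAt Γ _ u) - h (pointAt Γ _ s)
      ≈⟨ Line-increment h line s u ≤-refl (proj₁ s<b) (proj₁ s<t) t≤b ⟩
    m * (t - value s)                             ∎)
    where u = [ t , ≤-trans (0≤value s) (proj₁ s<t) , ≤-trans t≤b b≤L ]

  Line-slope-left : ∀ h {m k m′} (s : Parameter Γ e) → a < value s → 0# ≤ a →
                    Line h e a (value s) m k → HasSlope Γ h (direction e s backward) m′ → m′ ≈ - m
  Line-slope-left h {m} {m′ = m′} s a<s 0≤a line (ε , 0<ε , affine)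
    with near-left a<s 0<ε
  ... | t , t<s , a≤t , s-ε≤t = *-cancelʳ (x-y≉0 λ s≈t → <⇒≉ t<s (sym s≈t)) (begin
    m′ * (value s - t)                            ≈⟨ affine u s-ε≤t (proj₁ t<s) ⟨
    h (pointAt Γ _ u) - h (pointAt Γ _ s)
      ≈⟨ Line-increment h line s u (proj₁ a<s) ≤-refl a≤t (proj₁ t<s) ⟩
    m * (t - value s)
      ≈⟨ solve 3 (λ m s t → m :* (t :- s) := :- m :* (s :- t)) ≈-refl m (value s) t ⟩
    - m * (value s - t)                           ∎)
    where u = [ t , ≤-trans 0≤a a≤t , ≤-trans (proj₁ t<s) (value≤L s) ]

  -- An interior point has two directions: the forward one contributes `m′`, and the backward one
  -- `- m`, since distance is measured against the parameter.
  Line-kink : ∀ h {m k m′ k′ σ t} (0<t : 0# < t) (t<L : t < len e) →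
              0# ≤ a → a < t → t < b → b ≤ len e → Line h e a t m k → Line h e t b m′ k′ →
              IsSlopeSum Γ h (interior e t 0<t t<L) σ → σ ≈ m′ - m
  Line-kink h {m} {m′ = m′} {t = t} (0≤t , _) (t≤L , _) 0≤a a<t t<b b≤L left right
    (m₁ ∷ m₂ ∷ [] , forward-slope ∷ backward-slope ∷ [] , σ≈) =
    trans σ≈ (+-cong (Line-slope-right h s t<b b≤L right forward-slope)
                     (trans (+-identityʳ _) (Line-slope-left h s a<t 0≤a left backward-slope)))
    where s = [ t , 0≤t , t≤L ]

  -- Harmonic functions on an interval are affine.

  HarmonicOn : (Point Γ → Carrier) → Edge → (a b : Carrier) → Set _
  HarmonicOn h e a b = ∀ {t} (0<t : 0# < t) (t<L : t < len e) → a < t → t < b →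
                       IsSlopeSum Γ h (interior e t 0<t t<L) 0#

  PiecewiseAffineOn⇒< : PiecewiseAffineOn Γ h e a b → a < b
  PiecewiseAffineOn⇒< (piece a<b _) = a<b
  PiecewiseAffineOn⇒< (join f g)    = <-trans (PiecewiseAffineOn⇒< f) (PiecewiseAffineOn⇒< g)

  restrict : ∀ {a′ b′} → a ≤ a′ → a′ < b′ → b′ ≤ b →
             PiecewiseAffineOn Γ h e a b → PiecewiseAffineOn Γ h e a′ b′
  restrict a≤a′ a′<b′ b′≤b (piece a<b (m , k , line)) =
    piece a′<b′ (m , k , λ u a′≤u u≤b′ → line u (≤-trans a≤a′ a′≤u) (≤-trans u≤b′ b′≤b))
  restrict {a′ = a′} {b′} a≤a′ a′<b′ b′≤b (join {b = s} f g) with b′ ≤? s | s ≤? a′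
  ... | yes b′≤s | _        = restrict a≤a′ a′<b′ b′≤s f
  ... | no  _    | yes s≤a′ = restrict s≤a′ a′<b′ b′≤b g
  ... | no  b′≰s | no  s≰a′ = join (restrict a≤a′ (≰⇒> s≰a′) ≤-refl f) (restrict ≤-refl (≰⇒> b′≰s) b′≤b g)

  -- Induction on the pieces. At a break point the vanishing slope sum is the change of slope, so
  -- both neighbours have the same slope; they also share the value there, hence lie on one line.
  harmonic⇒affine : 0# ≤ a → b ≤ len e → HarmonicOn h e a b →
                    PiecewiseAffineOn Γ h e a b → AffineOn Γ h e a b
  harmonic⇒affine 0≤a b≤L harmonic (piece _ affine) = affine
  harmonic⇒affine {a} {b} {e} {h} 0≤a b≤L harmonic (join {b = s} f g) = glue
    (harmonic⇒affine 0≤a s≤L (λ 0<t t<L a<t t<s → harmonic 0<t t<L a<t (<-trans t<s s<b)) f)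
    (harmonic⇒affine 0≤s b≤L (λ 0<t t<L s<t t<b → harmonic 0<t t<L (<-trans a<s s<t) t<b) g)
    where
    a<s = PiecewiseAffineOn⇒< f
    s<b = PiecewiseAffineOn⇒< g
    0<s = ≤-<-trans 0≤a a<s
    s<L = <-≤-trans s<b b≤L
    0≤s = proj₁ 0<s
    s≤L = proj₁ s<L
    u₀  = [ s , 0≤s , s≤L ]

    glue : AffineOn Γ h e a s → AffineOn Γ h e s b → AffineOn Γ h e a b
    glue (m , k , left) (m′ , k′ , right) = m , k , line
      where
      slopes-agree : 0# ≈ m′ - m
      slopes-agree = Line-kink h 0<s s<L 0≤a a<s s<b b≤L left right (harmonic 0<s s<L a<s s<b)

      values-agree : m * s + k ≈ m′ * s + k′
      values-agree = trans (sym (left u₀ (proj₁ a<s) ≤-refl)) (right u₀ ≤-refl (proj₁ s<b))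

      line : Line h e a b m k
      line u a≤u u≤b with value u ≤? s
      ... | yes u≤s = left u a≤u u≤s
      -- Beyond `s`, the two lines differ by their difference at `s` plus the difference of slopes
      -- times the distance from `s`.
      ... | no  u≰s = trans (right u (proj₁ (≰⇒> u≰s)) u≤b) (combine
        (solve 6 (λ m k m′ k′ s t →
             m′ :* t :+ k′ :- (m :* t :+ k) :=
             (s :- t) :* (con (pos 0) :- (m′ :- m)) :+ (m′ :* s :+ k′ :- (m :* s :+ k)))
           ≈-refl m k m′ k′ s (value u))
        ((s - value u) ⊡ slopes-agree ⊞ difference (sym values-agree)))

  -- Slope sums at vertices and Green's identity.

  -- Records uniqueness of the end slopes; their existence comes with each given `IsSlopeSum`.
  record EndSlopes (h : Point Γ → Carrier) (e : Edge) (α β : Carrier) : Set (c ⊔ ℓ₁ ⊔ ℓ₂) where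
    field
      source-slope : ∀ {m} → HasSlope Γ h (direction e (atSource Γ e) forward) m → m ≈ α
      target-slope : ∀ {m} → HasSlope Γ h (direction e (atTarget Γ e) backward) m → m ≈ β
  open EndSlopes

  IsSlopeSum-resp : ∀ p {σ τ} → σ ≈ τ → IsSlopeSum Γ h p σ → IsSlopeSum Γ h p τ
  IsSlopeSum-resp _ σ≈τ (ms , slopes , σ≈) = ms , slopes , trans (sym σ≈τ) σ≈

  slopes-map : ∀ h {d : Edge → Direction Γ} {x : Edge → Carrier} →
               (∀ e {m} → HasSlope Γ h (d e) m → m ≈ x e) →
               ∀ es {ms} → Pointwise (HasSlope Γ h) (map d es) ms →
               foldr _+_ 0# ms ≈ foldr (λ e s → x e + s) 0# es
  slopes-map h unique []       []       = ≈-refl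
  slopes-map h unique (e ∷ es) (s ∷ ss) = +-cong (unique e s) (slopes-map h unique es ss)

  -- At a vertex, `directions` lists the outgoing block and then the incoming one. This evaluates
  -- the first block and hands the slopes of the second to `slopes-map`.
  slopes-++ : ∀ h {d : Edge → Direction Γ} {x : Edge → Carrier} →
              (∀ e {m} → HasSlope Γ h (d e) m → m ≈ x e) →
              ∀ es {ds ms} → Pointwise (HasSlope Γ h) (map d es ++ ds) ms →
              ∃ λ ns → Pointwise (HasSlope Γ h) ds ns ×
                       foldr _+_ 0# ms ≈ foldr (λ e s → x e + s) 0# es + foldr _+_ 0# ns
  slopes-++ h unique []       ss       = _ , ss , sym (+-identityˡ _)
  slopes-++ h unique (e ∷ es) (s ∷ ss) with slopes-++ h unique es ss
  ... | ns , ss′ , eq = ns , ss′ , trans (+-cong (unique e s) eq) (sym (+-assoc _ _ _))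

  module _ {h : Point Γ → Carrier} {α β : Edge → Carrier}
           (ends : ∀ (e : Edge) → EndSlopes h e (α e) (β e)) where

    vertex-slopeSum : ∀ {v σ} → IsSlopeSum Γ h (vertex v) σ →
                      σ ≈ ∑[ e < #E ] (if does (source e Fin.≟ v) then α e else 0#) +
                          ∑[ e < #E ] (if does (target e Fin.≟ v) then β e else 0#)
    vertex-slopeSum {v} (ms , slopes , σ≈)
      with slopes-++ h (λ e → source-slope (ends e)) (filter (λ e → source e Fin.≟ v) (allFin #E)) slopes
    ... | ns , slopes′ , eq = trans σ≈ (trans eq (+-cong
      (∑-filter (λ e → source e Fin.≟ v) α (λ e → e))
      (trans (slopes-map h (λ e → target-slope (ends e)) (filter (λ e → target e Fin.≟ v) (allFin #E)) slopes′)
             (∑-filter (λ e → target e Fin.≟ v) β (λ e → e)))))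

    -- Regroups the slopes by edges: every edge is met once at its source and once at its target, a
    -- loop both times at the same vertex.
    ∑-slopeSum : ∀ {σ : Vertex → Carrier} → (∀ v → IsSlopeSum Γ h (vertex v) (σ v)) →
                 ∀ (w : Vertex → Carrier) →
                 ∑[ v < #V ] (w v * σ v) ≈
                 ∑[ e < #E ] (w (source e) * α e + w (target e) * β e)
    ∑-slopeSum {σ} slopeSums w = begin
      ∑[ v < #V ] (w v * σ v)
        ≈⟨ sum-cong-≋ (λ v → trans (*-congˡ (vertex-slopeSum (slopeSums v))) (distribˡ _ _ _)) ⟩
      ∑[ v < #V ] (w v * out v + w v * into v)
        ≈⟨ ∑-distrib-+ (λ v → w v * out v) (λ v → w v * into v) ⟩
      ∑[ v < #V ] (w v * out v) + ∑[ v < #V ] (w v * into v)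
        ≈⟨ +-cong (∑-fibres source w α) (∑-fibres target w β) ⟩
      ∑[ e < #E ] (w (source e) * α e) + ∑[ e < #E ] (w (target e) * β e)
        ≈⟨ ∑-distrib-+ (λ e → w (source e) * α e) (λ e → w (target e) * β e) ⟨
      ∑[ e < #E ] (w (source e) * α e + w (target e) * β e) ∎
      where
      out into : Vertex → Carrier
      out  v = ∑[ e < #E ] (if does (source e Fin.≟ v) then α e else 0#)
      into v = ∑[ e < #E ] (if does (target e Fin.≟ v) then β e else 0#)

  -- Green's identity for functions whose boundary terms agree on every edge other than e.
  green : ∀ {f h} {αf βf : Edge → Carrier} {σf σh : Vertex → Carrier} {D} e →
    (∀ e′ → EndSlopes f e′ (αf e′) (βf e′)) →
    (∀ v → IsSlopeSum Γ f (vertex v) (σf v)) → (∀ v → IsSlopeSum Γ h (vertex v) (σh v)) →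
    (∀ e′ → ∃ λ α → ∃ λ β → EndSlopes h e′ α β ×
       f (vertex (source e′)) * α + f (vertex (target e′)) * β ≈
       (if does (e Fin.≟ e′) then D else 0#)
       + (h (vertex (source e′)) * αf e′ + h (vertex (target e′)) * βf e′)) →
    ∑[ v < #V ] (f (vertex v) * σh v) ≈ D + ∑[ v < #V ] (h (vertex v) * σf v)
  green {f} {h} {αf} {βf} {σf} {σh} {D} e f-ends f-sums h-sums h-edge = begin
    ∑[ v < #V ] (f (vertex v) * σh v)
      ≈⟨ ∑-slopeSum (λ e′ → proj₁ (proj₂ (proj₂ (h-edge e′)))) h-sums (λ v → f (vertex v)) ⟩
    ∑[ e′ < #E ] (f (vertex (source e′)) * proj₁ (h-edge e′)
                  + f (vertex (target e′)) * proj₁ (proj₂ (h-edge e′)))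
      ≈⟨ sum-cong-≋ (λ e′ → proj₂ (proj₂ (proj₂ (h-edge e′)))) ⟩
    ∑[ e′ < #E ] ((if does (e Fin.≟ e′) then D else 0#) + boundary e′)
      ≈⟨ ∑-distrib-+ (λ e′ → if does (e Fin.≟ e′) then D else 0#) boundary ⟩
    ∑[ e′ < #E ] (if does (e Fin.≟ e′) then D else 0#) + ∑[ e′ < #E ] boundary e′
      ≈⟨ +-cong (∑-indicator e (λ _ → D)) (sym (∑-slopeSum f-ends f-sums (λ v → h (vertex v)))) ⟩
    D + ∑[ v < #V ] (h (vertex v) * σf v) ∎
    where
    boundary : Edge → Carrier
    boundary e′ = h (vertex (source e′)) * αf e′ + h (vertex (target e′)) * βf e′

  -- The factor `1#` gives the result the shape `ι * w u`, shared with `∑-δ-interior`, where `ι` is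
  -- `0#`.
  ∑-δ-vertex : ∀ (w : Vertex → Carrier) u →
               ∑[ v < #V ] (w v * δ Γ (vertex u) (vertex v)) ≈ 1# * w u
  ∑-δ-vertex w u = begin
    ∑[ v < #V ] (w v * δ Γ (vertex u) (vertex v))
      ≈⟨ sum-cong-≋ (λ v → trans (*-congˡ (reflexive (δ-vertex v))) (*-if (does (u Fin.≟ v)) (w v) 1#)) ⟩
    ∑[ v < #V ] (if does (u Fin.≟ v) then w v * 1# else 0#)  ≈⟨ ∑-indicator u (λ v → w v * 1#) ⟩
    w u * 1#                                                  ≈⟨ *-comm _ _ ⟩
    1# * w u                                                  ∎
    where
    δ-vertex : ∀ v → δ Γ (vertex u) (vertex v) ≡ (if does (u Fin.≟ v) then 1# else 0#)
    δ-vertex v with u Fin.≟ v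
    ... | yes ≡.refl = ≡.refl
    ... | no  _      = ≡.refl

  ∑-δ-interior : ∀ (w : Vertex → Carrier) {p} → (∀ {v} → ¬ (_≈ᴾ_ Γ p (vertex v))) → ∀ z →
                 ∑[ v < #V ] (w v * δ Γ p (vertex v)) ≈ 0# * z
  ∑-δ-interior w {p} p≉vertex z = begin
    ∑[ v < #V ] (w v * δ Γ p (vertex v))
      ≈⟨ sum-cong-≋ (λ v → trans (*-congˡ (δ-≉ p≉vertex)) (zeroʳ (w v))) ⟩
    ∑[ v < #V ] 0#  ≈⟨ sum-replicate-zero #V ⟩
    0#              ≈⟨ zeroˡ z ⟨
    0# * z          ∎

  -- Harmonic edges and dipole potentials.

  harmonic-edge : ContinuousPiecewiseAffine Γ h → HarmonicOn h e 0# (len e) →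
                  ∃ λ m → EndSlopes h e m (- m) ×
                          h (vertex (target e)) - h (vertex (source e)) ≈ m * len e
  harmonic-edge {h} {e} cpa harmonic
    with harmonic⇒affine ≤-refl ≤-refl harmonic (ContinuousPiecewiseAffine.piecewiseAffine cpa e)
  ... | m , k , line = m , ends , (begin
    h (vertex (target e)) - h (vertex (source e))
      ≡⟨ ≡.cong₂ (λ p q → h p - h q) (pointAt-target (atTarget Γ e) ≈-refl)
                                     (pointAt-source (atSource Γ e) ≈-refl) ⟨
    h (pointAt Γ e (atTarget Γ e)) - h (pointAt Γ e (atSource Γ e))
      ≈⟨ Line-increment h line (atSource Γ e) (atTarget Γ e) ≤-refl 0≤L 0≤L ≤-refl ⟩
    m * (len e - 0#)
      ≈⟨ solve 2 (λ m L → m :* (L :- con (pos 0)) := m :* L) ≈-refl m (len e) ⟩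
    m * len e ∎)
    where
    0≤L = proj₁ (len-positive e)
    ends : EndSlopes h e m (- m)
    ends = record
      { source-slope = Line-slope-right h (atSource Γ e) (len-positive e) ≤-refl line
      ; target-slope = Line-slope-left h (atTarget Γ e) (len-positive e) ≤-refl line
      }

  -- The Laplacian of `h` is `ρ` times the difference of the point masses at `p` and `q`; the outer
  -- minus sign appears because the Laplacian is minus the slope sum. Replacing `ρ` by `- ρ`
  -- exchanges the poles.
  record IsDipole (ρ : Carrier) (p q : Point Γ) (h : Point Γ → Carrier) : Set (c ⊔ ℓ₁ ⊔ ℓ₂) where
    field
      continuousPiecewiseAffine : ContinuousPiecewiseAffine Γ h
      slopeSum : ∀ x → IsSlopeSum Γ h x (- (ρ * (δ Γ p x - δ Γ q x)))
  open IsDipole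

  dipole-harmonic : ∀ {ρ p q} → IsDipole ρ p q h → ∀ x → ¬ (_≈ᴾ_ Γ p x) → ¬ (_≈ᴾ_ Γ q x) →
                    IsSlopeSum Γ h x 0#
  dipole-harmonic {ρ = ρ} dipole x p≉x q≉x = IsSlopeSum-resp x
    (trans (-‿cong (*-congˡ (+-cong (δ-≉ p≉x) (-‿cong (δ-≉ q≉x)))))
           (solve 1 (λ ρ → :- (ρ :* (con (pos 0) :- con (pos 0))) := con (pos 0)) ≈-refl ρ))
    (slopeSum dipole x)

  -- A dipole with both poles on one edge.

  module _ {ρ : Carrier} {e : Edge} {x y : Parameter Γ e} (x<y : value x < value y)
           {h : Point Γ → Carrier} (dipole : IsDipole ρ (pointAt Γ e x) (pointAt Γ e y) h) where

    private
      cpa = continuousPiecewiseAffine dipole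
      pa  = ContinuousPiecewiseAffine.piecewiseAffine cpa e

    dipole-harmonicOn : (∀ {t} → a < t → t < b → ¬ (value x ≈ t)) →
                        (∀ {t} → a < t → t < b → ¬ (value y ≈ t)) → HarmonicOn h e a b
    dipole-harmonicOn x-off y-off 0<t t<L a<t t<b = dipole-harmonic dipole (interior e _ 0<t t<L)
      (λ p → x-off a<t t<b (proj₂ (pointAt-interior⁻¹ x p)))
      (λ p → y-off a<t t<b (proj₂ (pointAt-interior⁻¹ y p)))

    between : AffineOn Γ h e (value x) (value y)
    between = harmonic⇒affine (0≤value x) (value≤L y)
      (dipole-harmonicOn (λ x<t _ x≈t → <⇒≉ x<t x≈t) (λ _ t<y y≈t → <⇒≉ t<y (sym y≈t)))
      (restrict (0≤value x) x<y (value≤L y) pa)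

    other-edge : e ≢ e′ → HarmonicOn h e′ 0# (len e′)
    other-edge {e′} e≢e′ 0<t t<L _ _ = dipole-harmonic dipole (interior e′ _ 0<t t<L)
      (λ p → e≢e′ (proj₁ (pointAt-interior⁻¹ x p)))
      (λ p → e≢e′ (proj₁ (pointAt-interior⁻¹ y p)))

    -- ι is 1 if x is the source of e and 0 otherwise.  With it, the slope m + ρ
    -- before x makes sense even when that part of e is a single point.
    SourceSide : Carrier → Set _
    SourceSide m = ∃ λ ι →
      (∀ (w : Vertex → Carrier) →
         ∑[ v < #V ] (w v * δ Γ (pointAt Γ e x) (vertex v)) ≈ ι * w (source e)) ×
      (∀ {m′} → HasSlope Γ h (direction e (atSource Γ e) forward) m′ → m′ ≈ m + ρ - ρ * ι) ×
      h (pointAt Γ e x) - h (vertex (source e)) ≈ (m + ρ) * value x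

    -- If `x` is at the source, the middle piece starts there with slope `m`, which is
    -- `m + ρ - ρ * 1#`, and the increment before `x` is 0. Otherwise the charge at `x` lowers the
    -- slope by `ρ`, so the piece before `x` has slope `m + ρ`.
    source-side : ∀ {m k} → Line h e (value x) (value y) m k → SourceSide m
    source-side {m} {k} line = by-cases (value x ≟ 0#)
      where
      at-source : value x ≈ 0# → SourceSide m
      at-source x≈0 = 1# ,
        (λ w → ≡.subst (λ p → ∑[ v < #V ] (w v * δ Γ p (vertex v)) ≈ 1# * w (source e))
                 (≡.sym x≡source) (∑-δ-vertex w (source e))) ,
        (λ slope → trans
          (Line-slope-right h (atSource Γ e) (≤-<-trans (≤-reflexive (sym x≈0)) x<y) (value≤L y)
             (λ u 0≤u → line u (≤-trans (≤-reflexive x≈0) 0≤u)) slope)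
          (sym (trans (+-congˡ (-‿cong (*-identityʳ ρ)))
                      (solve 2 (λ m ρ → m :+ ρ :- ρ := m) ≈-refl m ρ)))) ,
        (begin
          h (pointAt Γ e x) - h (vertex (source e))      ≡⟨ ≡.cong (λ p → h p - h (vertex (source e))) x≡source ⟩
          h (vertex (source e)) - h (vertex (source e))  ≈⟨ -‿inverseʳ _ ⟩
          0#                                             ≈⟨ zeroʳ _ ⟨
          (m + ρ) * 0#                                   ≈⟨ *-congˡ x≈0 ⟨
          (m + ρ) * value x                              ∎)
        where x≡source = pointAt-source x x≈0

      away-from-source : ¬ (value x ≈ 0#) → SourceSide m
      away-from-source x≉0 = before (harmonic⇒affine ≤-refl (value≤L x)
          (dipole-harmonicOn (λ _ t<x x≈t → <⇒≉ t<x (sym x≈t))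
                             (λ _ t<x y≈t → <⇒≉ (<-trans t<x x<y) (sym y≈t)))
          (restrict ≤-refl 0<x (value≤L x) pa))
        where
        0<x : 0# < value x
        0<x = 0≤value x , λ 0≈x → x≉0 (sym 0≈x)

        x<L : value x < len e
        x<L = <-≤-trans x<y (value≤L y)

        before : AffineOn Γ h e 0# (value x) → SourceSide m
        before (m₀ , k₀ , line₀) = 0# ,
          (λ w → ∑-δ-interior w (pointAt-vertex⁻¹ x 0<x x<L) (w (source e))) ,
          (λ slope → trans (Line-slope-right h (atSource Γ e) 0<x (value≤L x) line₀ slope)
             (trans m₀≈m+ρ (solve 2 (λ m ρ → m :+ ρ := m :+ ρ :- ρ :* con (pos 0)) ≈-refl m ρ))) ,
          (begin
            h (pointAt Γ e x) - h (vertex (source e))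
              ≡⟨ ≡.cong (λ p → h (pointAt Γ e x) - h p) (pointAt-source (atSource Γ e) ≈-refl) ⟨
            h (pointAt Γ e x) - h (pointAt Γ e (atSource Γ e))
              ≈⟨ Line-increment h line₀ (atSource Γ e) x ≤-refl (0≤value x) (0≤value x) ≤-refl ⟩
            m₀ * (value x - 0#)
              ≈⟨ *-cong m₀≈m+ρ (solve 1 (λ x → x :- con (pos 0) := x) ≈-refl (value x)) ⟩
            (m + ρ) * value x ∎)
          where
          -- At this point the pole `x` has mass 1 and the pole `y`, having a larger parameter, has
          -- mass 0.
          kink : - (ρ * (1# - 0#)) ≈ m - m₀
          kink = Line-kink h 0<x x<L ≤-refl 0<x x<y (value≤L y) line₀ line
            (IsSlopeSum-resp (interior e (value x) 0<x x<L)
               (-‿cong (*-congˡ (+-cong (δ-≈ (pointAt-interior x 0<x x<L))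
                  (-‿cong (δ-≉ λ p → <⇒≉ x<y (sym (proj₂ (pointAt-interior⁻¹ y p))))))))
               (slopeSum dipole (interior e (value x) 0<x x<L)))

          m₀≈m+ρ : m₀ ≈ m + ρ
          m₀≈m+ρ = combine
            (solve 3 (λ m₀ m ρ → m₀ :- (m :+ ρ) := :- ρ :- (m :- m₀)) ≈-refl m₀ m ρ)
            (difference (trans (-‿cong (sym (trans (*-congˡ 1-0≈1) (*-identityʳ ρ)))) kink))
            where 1-0≈1 = solve 1 (λ x → x :- con (pos 0) := x) ≈-refl 1#

      by-cases : Dec (value x ≈ 0#) → SourceSide m
      by-cases (yes x≈0) = at-source x≈0
      by-cases (no  x≉0) = away-from-source x≉0

    -- The mirror image of `SourceSide`: seen from the target, the slope is reversed to `- (m + ρ)`,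
    -- and `ρ` is added back when `y` is itself the target.
    TargetSide : Carrier → Set _
    TargetSide m = ∃ λ ι →
      (∀ (w : Vertex → Carrier) →
         ∑[ v < #V ] (w v * δ Γ (pointAt Γ e y) (vertex v)) ≈ ι * w (target e)) ×
      (∀ {m′} → HasSlope Γ h (direction e (atTarget Γ e) backward) m′ → m′ ≈ - (m + ρ) + ρ * ι) ×
      h (vertex (target e)) - h (pointAt Γ e y) ≈ (m + ρ) * (len e - value y)

    -- The opposite charge at `y` raises the slope by `ρ`, back to `m + ρ`; if `y` is the target,
    -- the middle piece reaches the end of the edge and nothing remains after `y`.
    target-side : ∀ {m k} → Line h e (value x) (value y) m k → TargetSide m
    target-side {m} {k} line = by-cases (value y ≟ len e)
      where
      at-target : value y ≈ len e → TargetSide m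
      at-target y≈L = 1# ,
        (λ w → ≡.subst (λ p → ∑[ v < #V ] (w v * δ Γ p (vertex v)) ≈ 1# * w (target e))
                 (≡.sym y≡target) (∑-δ-vertex w (target e))) ,
        (λ slope → trans
          (Line-slope-left h (atTarget Γ e) (<-≤-trans x<y (≤-reflexive y≈L)) (0≤value x)
             (λ u x≤u u≤L → line u x≤u (≤-trans u≤L (≤-reflexive (sym y≈L)))) slope)
          (sym (trans (+-congˡ (*-identityʳ ρ))
                      (solve 2 (λ m ρ → :- (m :+ ρ) :+ ρ := :- m) ≈-refl m ρ)))) ,
        (begin
          h (vertex (target e)) - h (pointAt Γ e y)      ≡⟨ ≡.cong (λ p → h (vertex (target e)) - h p) y≡target ⟩
          h (vertex (target e)) - h (vertex (target e))  ≈⟨ -‿inverseʳ _ ⟩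
          0#                                             ≈⟨ zeroʳ _ ⟨
          (m + ρ) * 0#                                   ≈⟨ *-congˡ (-‿inverseʳ (len e)) ⟨
          (m + ρ) * (len e - len e)                      ≈⟨ *-congˡ (+-congˡ (-‿cong y≈L)) ⟨
          (m + ρ) * (len e - value y)                    ∎)
        where y≡target = pointAt-target y y≈L

      away-from-target : ¬ (value y ≈ len e) → TargetSide m
      away-from-target y≉L = after (harmonic⇒affine (0≤value y) ≤-refl
          (dipole-harmonicOn (λ y<t _ x≈t → <⇒≉ (<-trans x<y y<t) x≈t)
                             (λ y<t _ y≈t → <⇒≉ y<t y≈t))
          (restrict (0≤value y) y<L ≤-refl pa))
        where
        y<L : value y < len e
        y<L = value≤L y , y≉L

        0<y : 0# < value y
        0<y = ≤-<-trans (0≤value x) x<y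

        after : AffineOn Γ h e (value y) (len e) → TargetSide m
        after (m₁ , k₁ , line₁) = 0# ,
          (λ w → ∑-δ-interior w (pointAt-vertex⁻¹ y 0<y y<L) (w (target e))) ,
          (λ slope → trans (Line-slope-left h (atTarget Γ e) y<L (0≤value y) line₁ slope)
             (trans (-‿cong m₁≈m+ρ)
                    (solve 2 (λ m ρ → :- (m :+ ρ) := :- (m :+ ρ) :+ ρ :* con (pos 0)) ≈-refl m ρ))) ,
          (begin
            h (vertex (target e)) - h (pointAt Γ e y)
              ≡⟨ ≡.cong (λ p → h p - h (pointAt Γ e y)) (pointAt-target (atTarget Γ e) ≈-refl) ⟨
            h (pointAt Γ e (atTarget Γ e)) - h (pointAt Γ e y)
              ≈⟨ Line-increment h line₁ y (atTarget Γ e) ≤-refl (value≤L y) (value≤L y) ≤-refl ⟩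
            m₁ * (len e - value y)
              ≈⟨ *-congʳ m₁≈m+ρ ⟩
            (m + ρ) * (len e - value y) ∎)
          where
          kink : - (ρ * (0# - 1#)) ≈ m₁ - m
          kink = Line-kink h 0<y y<L (0≤value x) x<y y<L ≤-refl line line₁
            (IsSlopeSum-resp (interior e (value y) 0<y y<L)
               (-‿cong (*-congˡ (+-cong
                  (δ-≉ λ p → <⇒≉ x<y (proj₂ (pointAt-interior⁻¹ x p)))
                  (-‿cong (δ-≈ (pointAt-interior y 0<y y<L))))))
               (slopeSum dipole (interior e (value y) 0<y y<L)))

          m₁≈m+ρ : m₁ ≈ m + ρ
          m₁≈m+ρ = combine
            (solve 3 (λ m₁ m ρ → m₁ :- (m :+ ρ) := m₁ :- m :- ρ) ≈-refl m₁ m ρ)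
            (difference (trans (sym kink) (trans
              (solve 2 (λ ρ i → :- (ρ :* (con (pos 0) :- i)) := ρ :* i) ≈-refl ρ 1#)
              (*-identityʳ ρ))))

      by-cases : Dec (value y ≈ len e) → TargetSide m
      by-cases (yes y≈L) = at-target y≈L
      by-cases (no  y≉L) = away-from-target y≉L

    -- Reciprocity with the potential of the end points.

    module _ {f : Point Γ → Carrier}
             (f-dipole : IsDipole 1# (vertex (source e)) (vertex (target e)) f)
             (f-grounded : f (vertex (target e)) ≈ 0#)
             {k : Edge → Carrier}
             (f-edge : ∀ (e′ : Edge) → EndSlopes f e′ (k e′) (- k e′) ×
                                  f (vertex (target e′)) - f (vertex (source e′)) ≈ k e′ * len e′)
             {m m₀ : Carrier} (line : Line h e (value x) (value y) m m₀) where

      private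
        F H : Vertex → Carrier
        F v = f (vertex v)
        H v = h (vertex v)

        hx hy d : Carrier
        hx = h (pointAt Γ e x)
        hy = h (pointAt Γ e y)
        d  = value y - value x

        -- The Boolean is an argument so that a case distinction on the decision `e Fin.≟ e′`
        -- reduces the `if`.
        Balance : Carrier → Edge → Bool → Set _
        Balance D e′ same-edge = ∃ λ α → ∃ λ β → EndSlopes h e′ α β ×
          F (source e′) * α + F (target e′) * β ≈
          (if same-edge then D else 0#) + (H (source e′) * k e′ + H (target e′) * - k e′)

      h-edge : ∀ {ιx ιy} →
        (∀ {m′} → HasSlope Γ h (direction e (atSource Γ e) forward) m′ → m′ ≈ m + ρ - ρ * ιx) →
        (∀ {m′} → HasSlope Γ h (direction e (atTarget Γ e) backward) m′ → m′ ≈ - (m + ρ) + ρ * ιy) →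
        H (target e) - H (source e) ≈ (m + ρ) * len e - ρ * d →
        ∀ e′ → Balance (- (ρ * (ιx * F (source e) - ιy * F (target e))) - k e * (ρ * d)) e′
                       (does (e Fin.≟ e′))
      h-edge {ιx} {ιy} x-slope y-slope H-H≈ e′ = by-cases (e Fin.≟ e′)
        where
        charge : Carrier
        charge = - (ρ * (ιx * F (source e) - ιy * F (target e))) - k e * (ρ * d)

        harmonic : (∃ λ n → EndSlopes h e′ n (- n) × H (target e′) - H (source e′) ≈ n * len e′) →
                   Balance charge e′ false
        harmonic (n , ends , increment) =
          n , - n , ends , harmonic-edge-balance (proj₂ (f-edge e′)) increment

        by-cases : (e≟e′ : Dec (e ≡ e′)) → Balance charge e′ (does e≟e′)
        by-cases (yes ≡.refl) = m + ρ - ρ * ιx , - (m + ρ) + ρ * ιy ,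
          record { source-slope = x-slope ; target-slope = y-slope } ,
          charged-edge-balance (proj₂ (f-edge e)) H-H≈
        by-cases (no e≢e′) = harmonic (harmonic-edge cpa (other-edge e≢e′))

      -- Green's identity for `f` and `h`, summed over vertices. Poles of `h` inside the edge are
      -- invisible to these sums and enter through the defect of the edge `e`; poles at its ends
      -- appear on both sides with weights `ιx` and `ιy` and cancel. The poles of `f` pick out the
      -- values of `h` at the two ends.
      reciprocity : SourceSide m → TargetSide m →
                    H (target e) - H (source e) ≈ (m + ρ) * len e - ρ * d →
                    H (source e) - H (target e) ≈ - (k e * (ρ * d))
      reciprocity (ιx , ∑-source , x-slope , _) (ιy , ∑-target , y-slope , _) H-H≈ =
        charge-balance (begin
        - (ρ * (ιx * F (source e) - ιy * F (target e)))
          ≈⟨ -‿cong (*-congˡ (+-cong (∑-source F) (-‿cong (∑-target F)))) ⟨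
        - (ρ * (∑[ v < #V ] (F v * δ Γ (pointAt Γ e x) (vertex v))
                - ∑[ v < #V ] (F v * δ Γ (pointAt Γ e y) (vertex v))))
          ≈⟨ ∑-pairing-difference ρ F _ _ ⟨
        ∑[ v < #V ] (F v * - (ρ * (δ Γ (pointAt Γ e x) (vertex v) - δ Γ (pointAt Γ e y) (vertex v))))
          ≈⟨ green e (λ e′ → proj₁ (f-edge e′)) (λ v → slopeSum f-dipole (vertex v))
                   (λ v → slopeSum dipole (vertex v)) (h-edge x-slope y-slope H-H≈) ⟩
        (- (ρ * (ιx * F (source e) - ιy * F (target e))) - k e * (ρ * d))
        + ∑[ v < #V ] (H v * - (1# * (δ Γ (vertex (source e)) (vertex v)
                                      - δ Γ (vertex (target e)) (vertex v))))
          ≈⟨ +-congˡ (∑-pairing-difference 1# H _ _) ⟩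
        (- (ρ * (ιx * F (source e) - ιy * F (target e))) - k e * (ρ * d))
        + - (1# * (∑[ v < #V ] (H v * δ Γ (vertex (source e)) (vertex v))
                   - ∑[ v < #V ] (H v * δ Γ (vertex (target e)) (vertex v))))
          ≈⟨ +-congˡ (-‿cong (trans (*-identityˡ _)
               (+-cong (∑-δ-vertex H (source e)) (-‿cong (∑-δ-vertex H (target e)))))) ⟩
        (- (ρ * (ιx * F (source e) - ιy * F (target e))) - k e * (ρ * d))
        + - (1# * H (source e) - 1# * H (target e))
          ≈⟨ +-congˡ (-‿cong (+-cong (*-identityˡ _) (-‿cong (*-identityˡ _)))) ⟩
        (- (ρ * (ιx * F (source e) - ιy * F (target e))) - k e * (ρ * d))
        + - (H (source e) - H (target e)) ∎)

      drop-formula : SourceSide m → TargetSide m →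
        hx - hy ≈ ρ * (d - d ² * ((len e - F (source e)) / len e ²))
      drop-formula x-side@(_ , _ , _ , hx-H≈) y-side@(_ , _ , _ , H-hy≈) =
        resistance-formula {m = m} {ρ = ρ} L≉0 hy-hx≈ H-H≈ (reciprocity x-side y-side H-H≈) F-F≈
        where
        hy-hx≈ : hy - hx ≈ m * d
        hy-hx≈ = Line-increment h line x y ≤-refl (proj₁ x<y) (proj₁ x<y) ≤-refl

        H-H≈ : H (target e) - H (source e) ≈ (m + ρ) * len e - ρ * d
        H-H≈ = increments hx-H≈ hy-hx≈ H-hy≈

        -- Grounding at the target makes `F (source e)` the whole drop of `f` along `e`; it takes
        -- the part of the resistance `R`.
        F-F≈ : k e * len e ≈ - F (source e)
        F-F≈ = begin
          k e * len e                   ≈⟨ proj₂ (f-edge e) ⟨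
          F (target e) - F (source e)   ≈⟨ +-congʳ f-grounded ⟩
          0# - F (source e)             ≈⟨ +-identityˡ _ ⟩
          - F (source e)                ∎

        L≉0 : ¬ (len e ≈ 0#)
        L≉0 L≈0 = <⇒≉ (len-positive e) (sym L≈0)

    drop : ∀ {f} → IsDipole 1# (vertex (source e)) (vertex (target e)) f →
           f (vertex (target e)) ≈ 0# →
           h (pointAt Γ e x) - h (pointAt Γ e y) ≈
           ρ * (value y - value x
                - (value y - value x) ² * ((len e - f (vertex (source e))) / len e ²))
    drop {f} f-dipole f-grounded = conclude between
      where
      f-edge : ∀ e′ → ∃ λ k → EndSlopes f e′ k (- k) ×
                 f (vertex (target e′)) - f (vertex (source e′)) ≈ k * len e′
      f-edge e′ = harmonic-edge (continuousPiecewiseAffine f-dipole)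
        -- Both poles of `f` are vertices, which never equal an interior point, so `f` is harmonic
        -- inside every edge, including `e`.
        λ 0<t t<L _ _ → dipole-harmonic f-dipole (interior e′ _ 0<t t<L) (λ ()) (λ ())

      conclude : AffineOn Γ h e (value x) (value y) → _
      conclude (_ , _ , line) = drop-formula f-dipole f-grounded (λ e′ → proj₂ (f-edge e′))
                                  line (source-side line) (target-side line)

-- The resistance between two points of one edge.

lemma3p1 : ∀ {c ℓ₁ ℓ₂} (ℝ : RealNumbers c ℓ₁ ℓ₂) (Γ : MetrizedGraph ℝ) →
    let open RealNumbers ℝ
        open MetrizedGraph Γ
    in
    (r : Point Γ → Point Γ → Carrier) → IsResistanceFunction Γ r →
    (e : Edge) (x y : Parameter Γ e) →
    r (pointAt Γ e x) (pointAt Γ e y)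
      ≈ ∣ value x - value y ∣
        - (value x - value y) ² *
          ((len e - r (vertex (source e)) (vertex (target e))) / (len e) ²)
lemma3p1 ℝ Γ r (j , isVoltage , r≈j) e x y = by-cases (value x ≟ value y) (value x ≤? value y)
  where
  open RealNumbers ℝ
  open MetrizedGraph Γ
  open RealProperties ℝ
  open Potentials Γ
  open IntegerCoefficients commutativeRing
  open import Relation.Binary.Reasoning.Setoid setoid
  open IsVoltage

  P : Parameter Γ e → Point Γ
  P = pointAt Γ e

  s t : Point Γ
  s = vertex (source e)
  t = vertex (target e)

  C : Carrier
  C = (len e - r s t) / len e ²

  dipole : ∀ p q → IsDipole 1# p q (λ z → j q z p)
  dipole p q = record
    { continuousPiecewiseAffine = continuousPiecewiseAffine (isVoltage p q)
    ; slopeSum = λ z → let σ , slopes , δ≈-σ = laplacian (isVoltage p q) z in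
        IsSlopeSum-resp z (trans (sym (-‿involutive σ))
          (-‿cong (trans (sym δ≈-σ) (sym (*-identityˡ _))))) slopes
    }
    where open import Algebra.Properties.Ring ring using (-‿involutive)

  -- Serves the case `y < x`: `drop` expects the pole with the smaller parameter first, so the same
  -- voltage is read with poles exchanged and charge negated.
  reversed-dipole : ∀ p q → IsDipole (- 1#) q p (λ z → j q z p)
  reversed-dipole p q = record
    { continuousPiecewiseAffine = IsDipole.continuousPiecewiseAffine (dipole p q)
    ; slopeSum = λ z → IsSlopeSum-resp z
        (solve 3 (λ i a b → :- (i :* (a :- b)) := :- (:- i :* (b :- a))) ≈-refl 1# _ _)
        (IsDipole.slopeSum (dipole p q) z)
    }

  drop′ : ∀ {ρ x y} → value x < value y → ∀ {h} → IsDipole ρ (P x) (P y) h →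
          h (P x) - h (P y) ≈ ρ * (value y - value x - (value y - value x) ² * C)
  drop′ x<y h-dipole = trans (drop x<y h-dipole (dipole s t) (grounded (isVoltage s t)))
    (*-congˡ (+-congˡ (-‿cong (*-congˡ (*-congʳ (+-congˡ (-‿cong (sym (r≈j s t)))))))))

  voltage : Point Γ → Carrier
  voltage z = j (P y) z (P x)

  Goal : Set _
  Goal = r (P x) (P y) ≈ ∣ value x - value y ∣ - (value x - value y) ² * C

  -- The voltage vanishes at `P y`, so the resistance is a potential drop between the poles, the
  -- quantity that `drop` computes.
  r≈voltage : r (P x) (P y) ≈ voltage (P x) - voltage (P y)
  r≈voltage = begin
    r (P x) (P y)                    ≈⟨ r≈j (P x) (P y) ⟩
    voltage (P x)                    ≈⟨ solve 1 (λ v → v := v :- con (pos 0)) ≈-refl _ ⟩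
    voltage (P x) - 0#               ≈⟨ +-congˡ (-‿cong (grounded (isVoltage (P x) (P y)))) ⟨
    voltage (P x) - voltage (P y)    ∎

  equal : value x ≈ value y → Goal
  equal x≈y = begin
    r (P x) (P y)
      ≈⟨ r≈voltage ⟩
    voltage (P x) - voltage (P y)
      -- Equal parameters give points related by `_≈ᴾ_`, and the voltage respects this relation.
      ≈⟨ difference (ContinuousPiecewiseAffine.cong
           (continuousPiecewiseAffine (isVoltage (P x) (P y))) (pointAt-cong x y x≈y)) ⟩
    0#
      ≈⟨ solve 1 (λ C → con (pos 0) := con (pos 0) :- con (pos 0) :* con (pos 0) :* C) ≈-refl C ⟩
    0# - 0# ² * C
      ≈⟨ +-cong (trans (nonNeg⇒∣x∣≈x (≤-reflexive (sym x-y≈0))) x-y≈0)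
                (-‿cong (*-congʳ (*-cong x-y≈0 x-y≈0))) ⟨
    ∣ value x - value y ∣ - (value x - value y) ² * C ∎
    where x-y≈0 = difference x≈y

  increasing : value x < value y → Goal
  increasing x<y = begin
    r (P x) (P y)
      ≈⟨ r≈voltage ⟩
    voltage (P x) - voltage (P y)
      ≈⟨ drop′ x<y (dipole (P x) (P y)) ⟩
    1# * (value y - value x - (value y - value x) ² * C)
      ≈⟨ *-identityˡ _ ⟩
    value y - value x - (value y - value x) ² * C
      ≈⟨ solve 3 (λ x y C → y :- x :- (y :- x) :* (y :- x) :* C := :- (x :- y) :- (x :- y) :* (x :- y) :* C)
           ≈-refl (value x) (value y) C ⟩
    - (value x - value y) - (value x - value y) ² * C
      ≈⟨ +-congʳ (neg⇒∣x∣≈-x λ 0≤x-y → <⇒≱ x<y (0≤y-x⇒x≤y 0≤x-y)) ⟨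
    ∣ value x - value y ∣ - (value x - value y) ² * C ∎

  decreasing : value y < value x → Goal
  decreasing y<x = begin
    r (P x) (P y)
      ≈⟨ r≈voltage ⟩
    voltage (P x) - voltage (P y)
      ≈⟨ solve 2 (λ a b → a :- b := :- (b :- a)) ≈-refl (voltage (P x)) (voltage (P y)) ⟩
    - (voltage (P y) - voltage (P x))
      ≈⟨ -‿cong (drop′ y<x (reversed-dipole (P x) (P y))) ⟩
    - (- 1# * (value x - value y - (value x - value y) ² * C))
      ≈⟨ solve 2 (λ i z → :- (:- i :* z) := i :* z) ≈-refl 1# _ ⟩
    1# * (value x - value y - (value x - value y) ² * C)
      ≈⟨ *-identityˡ _ ⟩
    value x - value y - (value x - value y) ² * C
      ≈⟨ +-congʳ (nonNeg⇒∣x∣≈x (x≤y⇒0≤y-x (proj₁ y<x))) ⟨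
    ∣ value x - value y ∣ - (value x - value y) ² * C ∎

  -- Equality is decided first, so that the comparison afterwards yields a strict inequality in
  -- either direction.
  by-cases : Dec (value x ≈ value y) → Dec (value x ≤ value y) → Goal
  by-cases (yes x≈y) _         = equal x≈y
  by-cases (no  x≉y) (yes x≤y) = increasing (x≤y , x≉y)
  by-cases (no  _)   (no  x≰y) = decreasing (≰⇒> x≰y)
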